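{- There is $k\in\mathbb{N}_{>0}$ and a function $f(n,r)\in O(r\log n)$ such that for all $n,r\in\mathbb{N}_{>0}$ and all $i\in[(n+1)^r]$ there is a $\mathsf{C}^k[\tau^{(n)}]$-formula $\phi^{(n)}_i(x)$ of quantifier depth at most $f(n,r)$ such that for all directed graphs $G$ of order $|G|\le n$, all cardinality conditions $C$ for $G$ and all $v\in V(G)$: \[\mathcal{A}(G,C)\models\phi^{(n)}_i(v)\iff (v,i)\in X(G,C).\]
   Context: For a directed graph $G$, $N^+(v)$ is the set of out-neighbours and $\deg^-(w)$ the in-degree. A cardinality condition for $G$ is a map $C$ assigning to each $v\in V(G)$ a set $C(v)\subseteq\{0,1,\dots,\deg^+(v)\}$. $X(G,C)\subseteq V(G)\times\mathbb{N}_{>0}$ is the inclusionwise smallest set such that for all $v\in V(G)$ and $i\in\mathbb{N}_{>0}$: $(v,i)\in X(G,C)$ iff $\bigl|\{w\in N^+(v): (w,\lfloor (i-1)/\deg^-(w)\rfloor)\in X(G,C)\}\bigr|\in C(v)$. For $n\in\mathbb{N}_{>0}$, $\tau^{(n)}=\{E,P_0,\dots,P_n\}$ with $E$ binary and $P_j$ unary; $\mathcal{A}(G,C)$ is the $\tau^{(n)}$-structure with domain $V(G)$, $E$ interpreted as $E(G)$ and $P_j$ as $\{v: j\in C(v)\}$. $\mathsf{C}^k$ is first-order logic with counting quantifiers $\exists^{\ge m}x$ ($m\in\mathbb{N}$) restricted to the variables $x_1,\dots,x_k$; quantifier depth is the maximal nesting of quantifiers. $[m]=\{1,\dots,m\}$.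 -}

module Defs where

open import Data.Nat using (ℕ; zero; suc; _+_; _*_; _∸_; _^_; _≤_; _<_; _/_)
open import Data.Nat.Logarithm using (⌊log₂_⌋)
open import Data.Bool using (Bool; true; false; _∧_; _∨_; not; if_then_else_)
open import Data.Fin using (Fin; fromℕ<)
  renaming (zero to fzero; suc to fsuc)
import Data.Fin as Fin
open import Data.Product using (Σ; _×_; _,_)
open import Relation.Nullary.Decidable using (⌊_⌋)
open import Relation.Binary.PropositionalEquality using (_≡_)

count : ∀ {m} → (Fin m → Bool) → ℕ
count {zero}  p = 0
count {suc m} p = (if p fzero then 1 else 0) + count (λ x → p (fsuc x))

-- natural-number division, guarded against a zero divisor
-- (only used where the divisor is positive)
divℕ : ℕ → ℕ → ℕ
divℕ a zero    = 0
divℕ a (suc d) = a / suc d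

record DiGraph : Set where
  field
    order : ℕ
    E     : Fin order → Fin order → Bool

open DiGraph public

V : DiGraph → Set
V G = Fin (order G)

outdeg : (G : DiGraph) → V G → ℕ
outdeg G v = count (λ w → E G v w)

indeg : (G : DiGraph) → V G → ℕ
indeg G w = count (λ u → E G u w)

IsCardCond : (G : DiGraph) → (V G → ℕ → Bool) → Set
IsCardCond G C = ∀ v j → C v j ≡ true → j ≤ outdeg G v

-- The right-hand side of the defining equivalence of X(G,C):
-- |{ w ∈ N⁺(v) : (w, ⌊(i-1)/deg⁻(w)⌋) ∈ X }| ∈ C(v)
stepX : (G : DiGraph) → (V G → ℕ → Bool) → (V G → ℕ → Bool) → V G → ℕ → Bool
stepX G C X v i =
  C v (count (λ w → E G v w ∧ X w (divℕ (i ∸ 1) (indeg G w))))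

-- X ⊆ V(G) × ℕ_{>0} satisfying the defining equivalence
-- (subsets of V × ℕ encoded as characteristic functions; index 0 excluded)
ClosedX : (G : DiGraph) → (V G → ℕ → Bool) → (V G → ℕ → Bool) → Set
ClosedX G C X =
  (∀ v → X v 0 ≡ false) ×
  (∀ v i → 0 < i → X v i ≡ stepX G C X v i)

IsX : (G : DiGraph) → (V G → ℕ → Bool) → (V G → ℕ → Bool) → Set
IsX G C X =
  ClosedX G C X ×
  (∀ Y → ClosedX G C Y → ∀ v i → X v i ≡ true → Y v i ≡ true)

record Structure (n : ℕ) : Set where
  field
    size : ℕ
    Eʳ   : Fin size → Fin size → Bool
    Pʳ   : Fin (suc n) → Fin size → Bool

open Structure public

𝒜 : (n : ℕ) → (G : DiGraph) → (V G → ℕ → Bool) → Structure n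
𝒜 n G C = record
  { size = order G
  ; Eʳ   = E G
  ; Pʳ   = λ j v → C v (Fin.toℕ j)
  }

data Formula (k n : ℕ) : Set where
  rel     : Fin k → Fin k → Formula k n
  pred    : Fin (suc n) → Fin k → Formula k n
  eq      : Fin k → Fin k → Formula k n
  neg     : Formula k n → Formula k n
  conj    : Formula k n → Formula k n → Formula k n
  disj    : Formula k n → Formula k n → Formula k n
  exists≥ : ℕ → Fin k → Formula k n → Formula k n

_==_ : ∀ {k} → Fin k → Fin k → Bool
a == b = ⌊ a Fin.≟ b ⌋

free : ∀ {k n} → Fin k → Formula k n → Bool
free y (rel a b)       = (a == y) ∨ (b == y)
free y (pred j a)      = a == y
free y (eq a b)        = (a == y) ∨ (b == y)
free y (neg φ)         = free y φ
free y (conj φ ψ)      = free y φ ∨ free y ψ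
free y (disj φ ψ)      = free y φ ∨ free y ψ
free y (exists≥ m z φ) = not (z == y) ∧ free y φ

qd : ∀ {k n} → Formula k n → ℕ
qd (rel a b)       = 0
qd (pred j a)      = 0
qd (eq a b)        = 0
qd (neg φ)         = qd φ
qd (conj φ ψ)      = Data.Nat._⊔_ (qd φ) (qd ψ)
qd (disj φ ψ)      = Data.Nat._⊔_ (qd φ) (qd ψ)
qd (exists≥ m z φ) = suc (qd φ)

update : ∀ {k} {A : Set} → (Fin k → A) → Fin k → A → Fin k → A
update β z u y = if y == z then u else β y

sat : ∀ {k n} (𝔄 : Structure n) → (Fin k → Fin (size 𝔄)) → Formula k n → Bool
sat 𝔄 β (rel a b)       = Eʳ 𝔄 (β a) (β b)
sat 𝔄 β (pred j a)      = Pʳ 𝔄 j (β a)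
sat 𝔄 β (eq a b)        = β a == β b
sat 𝔄 β (neg φ)         = not (sat 𝔄 β φ)
sat 𝔄 β (conj φ ψ)      = sat 𝔄 β φ ∧ sat 𝔄 β ψ
sat 𝔄 β (disj φ ψ)      = sat 𝔄 β φ ∨ sat 𝔄 β ψ
sat 𝔄 β (exists≥ m z φ) =
  ⌊ m Data.Nat.≤? count (λ u → sat 𝔄 (update β z u) φ) ⌋

OnlyFree : ∀ {k n} → Fin k → Formula k n → Set
OnlyFree x φ = ∀ y → free y φ ≡ true → y ≡ x

BigO-r-log-n : (ℕ → ℕ → ℕ) → Set
BigO-r-log-n f =
  Σ ℕ λ c → Σ ℕ λ N → ∀ n r → N ≤ n → N ≤ r → f n r ≤ c * r * ⌊log₂ n ⌋

{-# OPTIONS --safe #-}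
module Submission where

-- Whether (v , i) ∈ X(G,C) is decided by evaluating the tree of all walks from v with resource i.
-- A walk that enters a node of in-degree d divides its resource by d, so at most (order G) * i ^ 2
-- nodes of this tree have positive resource.  The formula guesses a derivation of the value at
-- (v , i), possibly from an assumed value at one other pair (w , j), by two rules: "all children of
-- (v , i) have derived values", and "cut at some (z , l)".  In s rounds only quantifier depth s + 1 is
-- used, since all guessed resources and values are finite disjunctions.
-- Put M = i * (tree size).  A child of in-degree other than 1 has at most half the resource.  Hence,
-- following the heavy children of in-degree 1 from (v , i), one reaches a node all of whose children
-- have at most half the M, and cuts there.  The path to this node is bisected by cuts at the step where
-- the tree size crosses the mean of its two end values.  So O(log M) = O(r log n) rounds suffice.

open import Defs
open import Data.Nat using (ℕ; zero; suc; _+_; _*_; _∸_; _^_; _≤_; _<_; _≤?_; _<?_; z≤n; s≤s; _!)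
import Data.Nat as ℕ
open import Data.Nat.Properties hiding (_≟_)
open import Data.Nat.DivMod using (m/n≤m; m/n*n≤m; m*[n/m]≡n; n/1≡n)
open import Data.Nat.Divisibility using (_∣_; m≤n⇒m!∣n!; ∣-trans; m∣m*n)
open import Data.Nat.Logarithm using (⌊log₂_⌋; ⌊log₂⌋-mono-≤; ⌊log₂[2^n]⌋≡n)
open import Data.Nat.Solver using (module +-*-Solver)
open import Data.Fin using (Fin; toℕ; fromℕ<; _≟_) renaming (zero to fzero; suc to fsuc)
open import Data.Fin.Properties using (toℕ-fromℕ<; any?)
open import Data.Bool using (Bool; true; false; T; _∧_; _∨_; not; if_then_else_)
import Data.Bool as Bool
open import Data.Bool.Properties using (T-≡; T-not-≡; T-∧; T-∨)
open import Data.Empty using (⊥-elim)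
open import Data.Unit using (tt)
open import Data.Product using (Σ; ∃; _×_; _,_; proj₁; proj₂)
import Data.Sum as Sum
open import Data.Sum using (_⊎_; inj₁; inj₂)
open import Function using (_∘_)
open import Function.Bundles using (_⇔_; mk⇔; Equivalence)
open import Relation.Nullary using (¬_; Dec; yes; no)
open import Relation.Nullary.Decidable using (_×-dec_; ⌊_⌋; T?; decidable-stable; toWitness; fromWitness)
open import Relation.Binary.PropositionalEquality
open import Algebra.Properties.CommutativeMonoid.Sum +-0-commutativeMonoid
  using (sum; sum-cong-≗; ∑-comm; ∑-distrib-+)
open import Algebra.Properties.Semiring.Sum +-*-semiring using (*-distribˡ-sum; *-distribʳ-sum)
open import Algebra.Properties.CommutativeSemigroup *-commutativeSemigroup using (x∙yz≈y∙xz)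
open Equivalence using (to; from)

-- Guarded division, finite sums and counting.

divℕ-≤ : ∀ a d → divℕ a d ≤ a
divℕ-≤ a zero    = z≤n
divℕ-≤ a (suc d) = m/n≤m a (suc d)

*-divℕ-≤ : ∀ a d → d * divℕ a d ≤ a
*-divℕ-≤ a zero    = z≤n
*-divℕ-≤ a (suc d) = ≤-trans (≤-reflexive (*-comm (suc d) _)) (m/n*n≤m a (suc d))

m∣n! : ∀ {m n} → 0 < m → m ≤ n → m ∣ n !
m∣n! {suc m} _ m≤n = ∣-trans (m∣m*n (m !)) (m≤n⇒m!∣n! m≤n)

-- Every positive `d ≤ m` divides `m !`, so on the right the division is exact. Scaling by `m !`
-- thus trades a rounded quotient for an integer factor that does not depend on `a`.
!-*-divℕ-≤ : ∀ m a d → d ≤ m → m ! * divℕ a d ≤ a * divℕ (m !) d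
!-*-divℕ-≤ m a zero      _   = ≤-reflexive (trans (*-zeroʳ (m !)) (sym (*-zeroʳ a)))
!-*-divℕ-≤ m a d@(suc _) d≤m = begin
  m ! * divℕ a d       ≡⟨ cong (_* divℕ a d) (m*[n/m]≡n (m∣n! (s≤s z≤n) d≤m)) ⟨
  d * e * divℕ a d     ≡⟨ cong (_* divℕ a d) (*-comm d e) ⟩
  e * d * divℕ a d     ≡⟨ *-assoc e d _ ⟩
  e * (d * divℕ a d)   ≤⟨ *-monoʳ-≤ e (*-divℕ-≤ a d) ⟩
  e * a                ≡⟨ *-comm e a ⟩
  a * e                ∎
  where open ≤-Reasoning
        e = divℕ (m !) d

sum-mono-≤ : ∀ {m} {s t : Fin m → ℕ} → (∀ i → s i ≤ t i) → sum s ≤ sum t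
sum-mono-≤ {zero}  s≤t = z≤n
sum-mono-≤ {suc m} s≤t = +-mono-≤ (s≤t fzero) (sum-mono-≤ (s≤t ∘ fsuc))

term≤sum : ∀ {m} (t : Fin m → ℕ) a → t a ≤ sum t
term≤sum t fzero    = m≤m+n _ _
term≤sum t (fsuc a) = ≤-trans (term≤sum (t ∘ fsuc) a) (m≤n+m _ _)

two-terms≤sum : ∀ {m} (t : Fin m → ℕ) {a b} → a ≢ b → t a + t b ≤ sum t
two-terms≤sum t {fzero}  {fzero}  a≢b = ⊥-elim (a≢b refl)
two-terms≤sum t {fzero}  {fsuc b} a≢b = +-monoʳ-≤ _ (term≤sum (t ∘ fsuc) b)
two-terms≤sum t {fsuc a} {fzero}  a≢b =
  ≤-trans (≤-reflexive (+-comm (t (fsuc a)) _)) (+-monoʳ-≤ _ (term≤sum (t ∘ fsuc) a))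
two-terms≤sum t {fsuc a} {fsuc b} a≢b =
  ≤-trans (two-terms≤sum (t ∘ fsuc) (a≢b ∘ cong fsuc)) (m≤n+m _ _)

sum-const : ∀ m c → sum {m} (λ _ → c) ≡ m * c
sum-const zero    c = refl
sum-const (suc m) c = cong (c +_) (sum-const m c)

⟦_⟧ : Bool → ℕ
⟦ b ⟧ = if b then 1 else 0

count≡sum : ∀ {m} (p : Fin m → Bool) → count p ≡ sum (λ a → ⟦ p a ⟧)
count≡sum {zero}  p = refl
count≡sum {suc m} p = cong (⟦ p fzero ⟧ +_) (count≡sum (p ∘ fsuc))

count-cong : ∀ {m} {p q : Fin m → Bool} → (∀ a → p a ≡ q a) → count p ≡ count q
count-cong {zero}  p≗q = refl
count-cong {suc m} p≗q = cong₂ _+_ (cong ⟦_⟧ (p≗q fzero)) (count-cong (p≗q ∘ fsuc))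

count≤ : ∀ {m} (p : Fin m → Bool) → count p ≤ m
count≤ {zero}  p = z≤n
count≤ {suc m} p = +-mono-≤ (bit≤1 (p fzero)) (count≤ (p ∘ fsuc))
  where
  bit≤1 : ∀ b → ⟦ b ⟧ ≤ 1
  bit≤1 true  = ≤-refl
  bit≤1 false = z≤n

-- Size of the tree of all walks.

module Unravelling (G : DiGraph) where

  next : V G → ℕ → ℕ
  next w i = divℕ i (indeg G w)

  -- The number of nodes with positive resource, down to depth t, in the tree
  -- of all walks that start at v with resource i.
  treeSize : ℕ → V G → ℕ → ℕ
  treeSize zero    v i       = 0
  treeSize (suc t) v zero    = 0
  treeSize (suc t) v (suc i) = suc (sum λ w → ⟦ E G v w ⟧ * treeSize t w (next w i))

  -- The resource drops by at least one per level, so depth `i` already reaches every node of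
  -- positive resource. Hence `weight` below measures the whole tree.
  treeSize-stable : ∀ t t′ v i → i ≤ t → i ≤ t′ → treeSize t v i ≡ treeSize t′ v i
  treeSize-stable zero    zero     v zero    _ _ = refl
  treeSize-stable zero    (suc t′) v zero    _ _ = refl
  treeSize-stable (suc t) zero     v zero    _ _ = refl
  treeSize-stable (suc t) (suc t′) v zero    _ _ = refl
  treeSize-stable (suc t) (suc t′) v (suc i) (s≤s i≤t) (s≤s i≤t′) =
    cong suc (sum-cong-≗ λ w → cong (⟦ E G v w ⟧ *_)
      (treeSize-stable t t′ w (next w i) (≤-trans (i′≤i w) i≤t) (≤-trans (i′≤i w) i≤t′)))
    where
    i′≤i : ∀ w → next w i ≤ i
    i′≤i w = divℕ-≤ i (indeg G w)

  weight : V G → ℕ → ℕ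
  weight v i = treeSize i v i

  weight-suc : ∀ v i → weight v (suc i) ≡ suc (sum λ w → ⟦ E G v w ⟧ * weight w (next w i))
  weight-suc v i = cong suc (sum-cong-≗ λ w → cong (⟦ E G v w ⟧ *_)
    (treeSize-stable i (next w i) w (next w i) (divℕ-≤ i (indeg G w)) ≤-refl))

  0<weight : ∀ v i → 0 < weight v (suc i)
  0<weight v i = s≤s z≤n

  edge-term : ∀ {v w} i → E G v w ≡ true → ⟦ E G v w ⟧ * weight w (next w i) ≡ weight w (next w i)
  edge-term {v} {w} i e rewrite e = +-identityʳ _

  weight-child : ∀ {v w} i → E G v w ≡ true → weight w (next w i) < weight v (suc i)
  weight-child {v} {w} i e = begin-strict
    weight w (next w i)                ≡⟨ edge-term i e ⟨
    ⟦ E G v w ⟧ * weight w (next w i)  ≤⟨ term≤sum (λ w → ⟦ E G v w ⟧ * weight w (next w i)) w ⟩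
    sum (λ w → ⟦ E G v w ⟧ * weight w (next w i)) <⟨ n<1+n _ ⟩
    suc (sum (λ w → ⟦ E G v w ⟧ * weight w (next w i))) ≡⟨ weight-suc v i ⟨
    weight v (suc i) ∎
    where open ≤-Reasoning

  -- The tree of a child fits into the weight that is lost in passing to a sibling. This bounds the
  -- branches that leave a path.
  weight-children : ∀ {v w u} i → E G v w ≡ true → E G v u ≡ true → w ≢ u →
                    weight w (next w i) + weight u (next u i) < weight v (suc i)
  weight-children {v} {w} {u} i e e′ w≢u = begin-strict
    weight w (next w i) + weight u (next u i)  ≡⟨ cong₂ _+_ (edge-term i e) (edge-term i e′) ⟨
    term w + term u                            ≤⟨ two-terms≤sum term w≢u ⟩
    sum term                                   <⟨ n<1+n _ ⟩
    suc (sum term)                             ≡⟨ weight-suc v i ⟨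
    weight v (suc i)                           ∎
    where open ≤-Reasoning
          term : V G → ℕ
          term w = ⟦ E G v w ⟧ * weight w (next w i)

  private
    D : ℕ
    D = order G !

  -- D ^ t * (1 + K + ... + K ^ (t - 1)) applied to the constant function 1,
  -- where K v w = [E v w] / indeg w.  The columns of K sum to at most 1.
  potential : ℕ → V G → ℕ
  potential zero    v = 0
  potential (suc t) v = D ^ suc t + sum λ w → ⟦ E G v w ⟧ * (divℕ D (indeg G w) * potential t w)

  -- One factor `D` per level turns each division by an in-degree into multiplication by an integer,
  -- by `!-*-divℕ-≤`. The resulting bound is linear in the resource.
  treeSize≤potential : ∀ t v i → D ^ t * treeSize t v i ≤ i * potential t v
  treeSize≤potential zero    v i       = z≤n
  treeSize≤potential (suc t) v zero    = ≤-reflexive (*-zeroʳ (D ^ suc t))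
  treeSize≤potential (suc t) v (suc i) = begin
    D ^ suc t * suc (sum tree)                ≡⟨ *-suc (D ^ suc t) (sum tree) ⟩
    D ^ suc t + D ^ suc t * sum tree          ≡⟨ cong (D ^ suc t +_) (*-distribˡ-sum (D ^ suc t) tree) ⟩
    D ^ suc t + sum (λ w → D ^ suc t * tree w) ≤⟨ +-monoʳ-≤ (D ^ suc t) (sum-mono-≤ term≤) ⟩
    D ^ suc t + sum (λ w → i * flow w)        ≡⟨ cong (D ^ suc t +_) (*-distribˡ-sum i flow) ⟨
    D ^ suc t + i * sum flow                  ≤⟨ +-monoʳ-≤ (D ^ suc t) (*-monoʳ-≤ i (m≤n+m (sum flow) (D ^ suc t))) ⟩
    D ^ suc t + i * (D ^ suc t + sum flow)    ≤⟨ +-monoˡ-≤ _ (m≤m+n (D ^ suc t) (sum flow)) ⟩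
    suc i * (D ^ suc t + sum flow)            ∎
    where
    open ≤-Reasoning
    tree flow : V G → ℕ
    tree w = ⟦ E G v w ⟧ * treeSize t w (next w i)
    flow w = ⟦ E G v w ⟧ * (divℕ D (indeg G w) * potential t w)

    scaled : ∀ w → D ^ suc t * treeSize t w (next w i) ≤ i * (divℕ D (indeg G w) * potential t w)
    scaled w = begin
      D * D ^ t * treeSize t w (next w i)            ≡⟨ *-assoc D (D ^ t) _ ⟩
      D * (D ^ t * treeSize t w (next w i))          ≤⟨ *-monoʳ-≤ D (treeSize≤potential t w (next w i)) ⟩
      D * (next w i * potential t w)                 ≡⟨ *-assoc D (next w i) _ ⟨
      D * next w i * potential t w                   ≤⟨ *-monoˡ-≤ (potential t w) (!-*-divℕ-≤ (order G) i (indeg G w) (count≤ (λ u → E G u w))) ⟩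
      i * divℕ D (indeg G w) * potential t w         ≡⟨ *-assoc i (divℕ D (indeg G w)) _ ⟩
      i * (divℕ D (indeg G w) * potential t w)       ∎

    term≤ : ∀ w → D ^ suc t * tree w ≤ i * flow w
    term≤ w with E G v w
    ... | false = ≤-reflexive (trans (*-zeroʳ (D ^ suc t)) (sym (*-zeroʳ i)))
    ... | true rewrite +-identityʳ (treeSize t w (next w i))
                     | +-identityʳ (divℕ D (indeg G w) * potential t w) = scaled w

  -- Summing over all start nodes and exchanging the sums brings in the columns of `K`. Since these
  -- sum to at most 1, each of the `t` powers contributes at most `order G`, up to the scaling.
  sum-potential≤ : ∀ t → sum (potential t) ≤ order G * (t * D ^ t)
  sum-potential≤ zero = ≤-reflexive (sum-const (order G) 0)
  sum-potential≤ (suc t) = begin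
    sum (potential (suc t))                                          ≡⟨ ∑-distrib-+ (λ _ → D ^ suc t) (λ v → sum λ w → ⟦ E G v w ⟧ * flow w) ⟩
    sum {order G} (λ _ → D ^ suc t) + sum (λ v → sum (λ w → ⟦ E G v w ⟧ * flow w))
      ≡⟨ cong₂ _+_ (sum-const (order G) (D ^ suc t)) (∑-comm λ v w → ⟦ E G v w ⟧ * flow w) ⟩
    order G * D ^ suc t + sum (λ w → sum (λ v → ⟦ E G v w ⟧ * flow w))  ≤⟨ +-monoʳ-≤ (order G * D ^ suc t) (sum-mono-≤ column) ⟩
    order G * D ^ suc t + sum (λ w → D * potential t w)              ≡⟨ cong (order G * D ^ suc t +_) (*-distribˡ-sum D (potential t)) ⟨
    order G * D ^ suc t + D * sum (potential t)                      ≤⟨ +-monoʳ-≤ (order G * D ^ suc t) (*-monoʳ-≤ D (sum-potential≤ t)) ⟩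
    order G * D ^ suc t + D * (order G * (t * D ^ t))                ≡⟨ cong (order G * D ^ suc t +_) swap ⟩
    order G * D ^ suc t + order G * (t * D ^ suc t)                  ≡⟨ *-distribˡ-+ (order G) (D ^ suc t) _ ⟨
    order G * (suc t * D ^ suc t)                                    ∎
    where
    open ≤-Reasoning
    flow : V G → ℕ
    flow w = divℕ D (indeg G w) * potential t w

    column : ∀ w → sum (λ v → ⟦ E G v w ⟧ * flow w) ≤ D * potential t w
    column w = begin
      sum (λ v → ⟦ E G v w ⟧ * flow w)                 ≡⟨ *-distribʳ-sum (flow w) (λ v → ⟦ E G v w ⟧) ⟨
      sum (λ v → ⟦ E G v w ⟧) * flow w                 ≡⟨ cong (_* flow w) (count≡sum (λ v → E G v w)) ⟨
      indeg G w * (divℕ D (indeg G w) * potential t w) ≡⟨ *-assoc (indeg G w) (divℕ D (indeg G w)) _ ⟨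
      indeg G w * divℕ D (indeg G w) * potential t w   ≤⟨ *-monoˡ-≤ (potential t w) (*-divℕ-≤ D (indeg G w)) ⟩
      D * potential t w                                ∎

    swap : D * (order G * (t * D ^ t)) ≡ order G * (t * D ^ suc t)
    swap = begin-equality
      D * (order G * (t * D ^ t))   ≡⟨ x∙yz≈y∙xz D (order G) _ ⟩
      order G * (D * (t * D ^ t))   ≡⟨ cong (order G *_) (x∙yz≈y∙xz D t _) ⟩
      order G * (t * (D * D ^ t))   ∎

  -- A single potential is at most the sum of all. One factor `i` is the initial resource, the other
  -- is the number of levels; the scaling `D ^ i` cancels.
  weight≤ : ∀ v i → weight v i ≤ i * (order G * i)
  weight≤ v i = *-cancelˡ-≤ (D ^ i) {{m^n≢0 D i {{order G !≢0}}}} (begin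
    D ^ i * weight v i                ≤⟨ treeSize≤potential i v i ⟩
    i * potential i v                 ≤⟨ *-monoʳ-≤ i (≤-trans (term≤sum (potential i) v) (sum-potential≤ i)) ⟩
    i * (order G * (i * D ^ i))       ≡⟨ cong (i *_) (*-assoc (order G) i _) ⟨
    i * (order G * i * D ^ i)         ≡⟨ *-assoc i (order G * i) _ ⟨
    i * (order G * i) * D ^ i         ≡⟨ *-comm _ (D ^ i) ⟩
    D ^ i * (i * (order G * i))       ∎)
    where open ≤-Reasoning

-- Walks through nodes of in-degree 1.

module Paths (G : DiGraph) where
  open Unravelling G

  -- Walks all of whose nodes but the first have in-degree 1.
  data Path : V G → ℕ → V G → ℕ → Set where
    nil  : ∀ {v i} → Path v i v i
    cons : ∀ {v x w i j} → E G v x ≡ true → indeg G x ≡ 1 → Path x i w j → Path v (suc i) w j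

  next-indeg-1 : ∀ {x} i → indeg G x ≡ 1 → next x i ≡ i
  next-indeg-1 i d rewrite d = n/1≡n i

  weight-edge : ∀ {v x} i → E G v x ≡ true → indeg G x ≡ 1 → weight x i < weight v (suc i)
  weight-edge {v} {x} i e d =
    subst (λ k → weight x k < weight v (suc i)) (next-indeg-1 i d) (weight-child i e)

  path-≤ : ∀ {v i w j} → Path v i w j → j ≤ i
  path-≤ nil          = ≤-refl
  path-≤ (cons _ _ p) = m≤n⇒m≤1+n (path-≤ p)

  path-weight : ∀ {v i w j} → Path v i w j → weight w j ≤ weight v i
  path-weight nil                  = ≤-refl
  path-weight (cons {i = i} e d p) = ≤-trans (path-weight p) (<⇒≤ (weight-edge i e d))

  -- A discrete intermediate value principle. It later finds the edge at which the weight passes the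
  -- mean of its end values.
  crossing : ∀ {P : V G → ℕ → Set} → (∀ x k → Dec (P x k)) →
             ∀ {v i w j} → Path v i w j → P v i → ¬ P w j →
             ∃ λ x → ∃ λ y → ∃ λ k → Path v i x (suc k) × E G x y ≡ true × indeg G y ≡ 1 ×
               Path y k w j × P x (suc k) × ¬ P y k
  crossing P? nil Pv ¬Pw = ⊥-elim (¬Pw Pv)
  crossing P? (cons {v} {x} {i = i} e d p) Pv ¬Pw with P? x i
  ... | no ¬Px = v , x , i , nil , e , d , p , Pv , ¬Px
  ... | yes Px =
    let x′ , y , k , q , rest = crossing P? p Px ¬Pw in x′ , y , k , cons e d q , rest

  -- Move on to a child of in-degree 1 as long as one has more than half of the fixed budget `B`.
  -- The resource falls by one with each move, so this stops.
  heavy-end : ∀ B i v → B < 2 * weight v (suc i) →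
              ∃ λ w → ∃ λ j → Path v (suc i) w (suc j) × B < 2 * weight w (suc j) ×
                (∀ y → E G w y ≡ true → indeg G y ≡ 1 → 2 * weight y j ≤ B)
  heavy-end B i v B<
    with any? (λ y → (E G v y Bool.≟ true) ×-dec (indeg G y ℕ.≟ 1) ×-dec (B <? 2 * weight y i))
  ... | no none = v , i , nil , B< , λ y e d → ≮⇒≥ λ B<y → none (y , e , d , B<y)
  -- With resource `suc 0` the children have weight 0, which is never more than half of `B`; that
  -- case is empty.
  heavy-end B (suc i) v B< | yes (y , e , d , B<y) =
    let w , j , p , rest = heavy-end B i y B<y in w , j , cons e d p , rest

-- The formulas.

==-refl : ∀ {k} (x : Fin k) → (x == x) ≡ true
==-refl x = to T-≡ (fromWitness {a? = x ≟ x} refl)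

==-≢ : ∀ {k} {x y : Fin k} → x ≢ y → (x == y) ≡ false
==-≢ {x = x} {y} x≢y with x ≟ y
... | yes x≡y = ⊥-elim (x≢y x≡y)
... | no  _   = refl

module _ {k n : ℕ} where

  -- The index type is nonempty because the syntax has no constant for falsity.
  ⋁ : ∀ {m} → (Fin (suc m) → Formula k n) → Formula k n
  ⋁ {zero}  φ = φ fzero
  ⋁ {suc m} φ = disj (φ fzero) (⋁ (φ ∘ fsuc))

  literal : Bool → Formula k n → Formula k n
  literal true  φ = φ
  literal false φ = neg φ

  exactly : ℕ → Fin k → Formula k n → Formula k n
  exactly m z φ = conj (exists≥ m z φ) (neg (exists≥ (suc m) z φ))

  -- The variable `x` is bound again only inside the count of in-neighbours of `z`; `φ` stays
  -- outside that scope and may still speak of the old `x`. This reuse keeps the number of variables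
  -- at three.
  atInDegree : Fin k → Fin k → (ℕ → Formula k n) → Formula k n
  atInDegree x z φ = ⋁ {n} λ d → conj (exactly (toℕ d) x (rel x z)) (φ (toℕ d))

  -- Resources and values are known when the formula is built, so only the equality of nodes is left
  -- to the structure; `neg (eq x x)` stands for falsity.
  assumption : Fin k → Fin k → ℕ → Bool → ℕ → Bool → Formula k n
  assumption x y j b i c = if ⌊ (i ℕ.≟ j) ×-dec (c Bool.≟ b) ⌋ then eq x y else neg (eq x x)

  -- φ b d is to express that the value of the child z is b, if z has in-degree d.
  step : Fin k → Fin k → (Bool → ℕ → Formula k n) → Bool → Formula k n
  step x z φ c = conj
    (neg (exists≥ 1 z (conj (rel x z) (neg (disj (atInDegree x z (φ true)) (atInDegree x z (φ false)))))))
    (⋁ {n} λ m → conj (exactly (toℕ m) z (conj (rel x z) (atInDegree x z (φ true)))) (literal c (pred m x)))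

  cut : Fin k → ∀ {m} → (Bool → ℕ → Formula k n) → Formula k n
  cut z {m} φ = ⋁ {m} λ l → exists≥ 1 z (disj (φ true (toℕ l)) (φ false (toℕ l)))

  -- "(x , i) has value c, assuming that (y , j) has value b", as far as this can be derived
  -- in s rounds.  The variable z is scratch space.
  derive : ℕ → Fin k → Fin k → Fin k → ℕ → Bool → ℕ → Bool → Formula k n
  derive s       x y z j b zero    c = literal (not c) (eq x x)
  derive zero    x y z j b (suc i) c = assumption x y j b (suc i) c
  derive (suc s) x y z j b (suc i) c = disj (assumption x y j b (suc i) c) (disj
    (step x z (λ b′ d → derive s z y x j b (divℕ i d) b′) c)
    (cut z {suc i} λ b′ l → conj (derive s z y x j b l b′) (derive s x z y l b′ (suc i) c)))

  private variable φ : Formula k n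

  -- Quantifier depth and free variables.

  qd-⋁ : ∀ {m} (φ : Fin (suc m) → Formula k n) → ∀ {q} → (∀ a → qd (φ a) ≤ q) → qd (⋁ φ) ≤ q
  qd-⋁ {zero}  φ h = h fzero
  qd-⋁ {suc m} φ h = ⊔-lub (h fzero) (qd-⋁ (φ ∘ fsuc) (h ∘ fsuc))

  qd-literal : ∀ c → qd (literal c φ) ≡ qd φ
  qd-literal true  = refl
  qd-literal false = refl

  qd-assumption : ∀ x y j b i c → qd (assumption x y j b i c) ≡ 0
  qd-assumption x y j b i c with ⌊ (i ℕ.≟ j) ×-dec (c Bool.≟ b) ⌋
  ... | true  = refl
  ... | false = refl

  qd-atInDegree : ∀ x z {q} (φ : ℕ → Formula k n) → 1 ≤ q → (∀ d → qd (φ d) ≤ q) → qd (atInDegree x z φ) ≤ q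
  qd-atInDegree x z φ 1≤q h =
    qd-⋁ {n} (λ d → conj (exactly (toℕ d) x (rel x z)) (φ (toℕ d))) λ d → ⊔-lub 1≤q (h (toℕ d))

  qd-step : ∀ x z {q} (φ : Bool → ℕ → Formula k n) c → (∀ b d → qd (φ b d) ≤ suc q) →
            qd (step x z φ c) ≤ suc (suc q)
  qd-step x z φ c h = ⊔-lub (s≤s (⊔-lub z≤n (⊔-lub (child true) (child false))))
    (qd-⋁ {n} (λ m → conj (exactly (toℕ m) z (conj (rel x z) (atInDegree x z (φ true)))) (literal c (pred m x)))
      λ m → ⊔-lub (⊔-lub (s≤s (child true)) (s≤s (child true)))
                  (≤-trans (≤-reflexive (qd-literal {φ = pred m x} c)) z≤n))
    where
    child : ∀ b → qd (atInDegree x z (φ b)) ≤ suc _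
    child b = qd-atInDegree x z (φ b) (s≤s z≤n) (h b)

  qd-cut : ∀ z {m q} (φ : Bool → ℕ → Formula k n) → (∀ b l → qd (φ b l) ≤ q) → qd (cut z {m} φ) ≤ suc q
  qd-cut z {m} φ h = qd-⋁ {m} (λ l → exists≥ 1 z (disj (φ true (toℕ l)) (φ false (toℕ l))))
    λ l → s≤s (⊔-lub (h true (toℕ l)) (h false (toℕ l)))

  -- Each round adds one quantifier over a node. The additional one pays for the in-degree count in
  -- the innermost `step`.
  qd-derive : ∀ s x y z j b i c → qd (derive s x y z j b i c) ≤ suc s
  qd-derive s x y z j b zero c = ≤-trans (≤-reflexive (qd-literal {φ = eq x x} (not c))) z≤n
  qd-derive zero x y z j b (suc i) c = ≤-trans (≤-reflexive (qd-assumption x y j b (suc i) c)) z≤n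
  qd-derive (suc s) x y z j b (suc i) c =
    ⊔-lub (≤-trans (≤-reflexive (qd-assumption x y j b (suc i) c)) z≤n) (⊔-lub
      (qd-step x z (λ b′ d → derive s z y x j b (divℕ i d) b′) c
        λ b′ d → qd-derive s z y x j b (divℕ i d) b′)
      (qd-cut z {suc i} (λ b′ l → conj (derive s z y x j b l b′) (derive s x z y l b′ (suc i) c))
        λ b′ l → ⊔-lub (qd-derive s z y x j b l b′) (qd-derive s x z y l b′ (suc i) c)))

  free-⋁ : ∀ {m} z (φ : Fin (suc m) → Formula k n) → (∀ a → free z (φ a) ≡ false) → free z (⋁ φ) ≡ false
  free-⋁ {zero}  z φ h = h fzero
  free-⋁ {suc m} z φ h = cong₂ _∨_ (h fzero) (free-⋁ z (φ ∘ fsuc) (h ∘ fsuc))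

  free-exists : ∀ m z (φ : Formula k n) → free z (exists≥ m z φ) ≡ false
  free-exists m z φ rewrite ==-refl z = refl

  free-literal : ∀ c z → free z (literal c φ) ≡ free z φ
  free-literal true  z = refl
  free-literal false z = refl

  free-assumption : ∀ {x y z} j b i c → x ≢ z → y ≢ z → free z (assumption x y j b i c) ≡ false
  free-assumption j b i c x≢z y≢z with ⌊ (i ℕ.≟ j) ×-dec (c Bool.≟ b) ⌋
  ... | true  = cong₂ _∨_ (==-≢ x≢z) (==-≢ y≢z)
  ... | false = cong₂ _∨_ (==-≢ x≢z) (==-≢ x≢z)

  free-step : ∀ {x z} (φ : Bool → ℕ → Formula k n) c → x ≢ z → free z (step x z φ c) ≡ false
  free-step {x} {z} φ c x≢z = cong₂ _∨_
    (free-exists 1 z (conj (rel x z) (neg (disj (atInDegree x z (φ true)) (atInDegree x z (φ false))))))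
    (free-⋁ {n} z (λ m → conj (exactly (toℕ m) z trueChild) (literal c (pred m x)))
      λ m → cong₂ _∨_ (cong₂ _∨_ (free-exists (toℕ m) z trueChild) (free-exists (suc (toℕ m)) z trueChild))
                      (trans (free-literal {φ = pred m x} c z) (==-≢ x≢z)))
    where
    trueChild : Formula k n
    trueChild = conj (rel x z) (atInDegree x z (φ true))

  free-cut : ∀ z {m} (φ : Bool → ℕ → Formula k n) → free z (cut z {m} φ) ≡ false
  free-cut z {m} φ = free-⋁ {m} z (λ l → exists≥ 1 z (disj (φ true (toℕ l)) (φ false (toℕ l))))
    λ l → free-exists 1 z (disj (φ true (toℕ l)) (φ false (toℕ l)))

  free-derive : ∀ s {x y z} j b i c → x ≢ z → y ≢ z → free z (derive s x y z j b i c) ≡ false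
  free-derive s {x} {z = z} j b zero c x≢z y≢z =
    trans (free-literal {φ = eq x x} (not c) z) (cong₂ _∨_ (==-≢ x≢z) (==-≢ x≢z))
  free-derive zero j b (suc i) c x≢z y≢z = free-assumption j b (suc i) c x≢z y≢z
  free-derive (suc s) {x} {y} {z} j b (suc i) c x≢z y≢z =
    cong₂ _∨_ (free-assumption j b (suc i) c x≢z y≢z) (cong₂ _∨_
      (free-step (λ b′ d → derive s z y x j b (divℕ i d) b′) c x≢z)
      (free-cut z {suc i} λ b′ l → conj (derive s z y x j b l b′) (derive s x z y l b′ (suc i) c)))

-- Satisfaction of the logical connectives and quantifiers.

module _ {k : ℕ} {A : Set} (β : Fin k → A) (z : Fin k) (u : A) where

  update-same : update β z u z ≡ u
  update-same rewrite ==-refl z = refl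

  update-other : ∀ {y} → y ≢ z → update β z u y ≡ β y
  update-other y≢z rewrite ==-≢ y≢z = refl

count-positive : ∀ {m} {p : Fin m → Bool} → 1 ≤ count p → ∃ λ a → T (p a)
count-positive {suc m} {p} 1≤ with p fzero in eq
... | true  = fzero , from T-≡ eq
... | false = let a , pa = count-positive 1≤ in fsuc a , pa

positive-count : ∀ {m} {p : Fin m → Bool} a → T (p a) → 1 ≤ count p
positive-count {p = p} fzero    pa with p fzero
... | true = s≤s z≤n
positive-count (fsuc a) pa = ≤-trans (positive-count a pa) (m≤n+m _ _)

T-not : ∀ {b} → T (not b) ⇔ (¬ T b)
T-not {true}  = mk⇔ (λ ()) (λ ¬tt → ¬tt tt)
T-not {false} = mk⇔ (λ _ ()) (λ _ → tt)

module Satisfaction {k n : ℕ} (𝔄 : Structure n) where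

  infix 4 _⊨_
  -- A record, so that β and φ can be inferred from a proof of β ⊨ φ.
  record _⊨_ (β : Fin k → Fin (size 𝔄)) (φ : Formula k n) : Set where
    constructor ⟪_⟫
    field holds : T (sat 𝔄 β φ)

  open _⊨_ public

  private variable
    β : Fin k → Fin (size 𝔄)
    φ ψ : Formula k n
    x y z : Fin k
    m : ℕ

  ⊨-true : β ⊨ φ ⇔ sat 𝔄 β φ ≡ true
  ⊨-true = mk⇔ (λ h → to T-≡ (holds h)) (λ e → ⟪ from T-≡ e ⟫)

  ⊨-conj : β ⊨ conj φ ψ ⇔ (β ⊨ φ × β ⊨ ψ)
  ⊨-conj = mk⇔ (λ h → let h₁ , h₂ = to T-∧ (holds h) in ⟪ h₁ ⟫ , ⟪ h₂ ⟫)
               (λ (h₁ , h₂) → ⟪ from T-∧ (holds h₁ , holds h₂) ⟫)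

  ⊨-disj : β ⊨ disj φ ψ ⇔ (β ⊨ φ ⊎ β ⊨ ψ)
  ⊨-disj = mk⇔ (λ h → Sum.map ⟪_⟫ ⟪_⟫ (to T-∨ (holds h)))
               (λ h → ⟪ from T-∨ (Sum.map holds holds h) ⟫)

  ⊨-neg : β ⊨ neg φ ⇔ (¬ β ⊨ φ)
  ⊨-neg = mk⇔ (λ h h′ → to T-not (holds h) (holds h′)) (λ h → ⟪ from T-not (λ h′ → h ⟪ h′ ⟫) ⟫)

  stable : ¬ ¬ (β ⊨ φ) → β ⊨ φ
  stable {β} {φ} ¬¬h = ⟪ decidable-stable (T? (sat 𝔄 β φ)) (λ ¬h → ¬¬h (¬h ∘ holds)) ⟫

  ⊨-⋁ : {φ : Fin (suc m) → Formula k n} → β ⊨ ⋁ φ ⇔ ∃ λ a → β ⊨ φ a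
  ⊨-⋁ {zero} {β} {φ} = mk⇔ (λ h → fzero , h) g
    where
    g : (∃ λ a → β ⊨ φ a) → β ⊨ φ fzero
    g (fzero , h) = h
  ⊨-⋁ {suc m} {β} {φ} = mk⇔ f g
    where
    f : β ⊨ ⋁ φ → ∃ λ a → β ⊨ φ a
    f h with to ⊨-disj h
    ... | inj₁ h₀ = fzero , h₀
    ... | inj₂ h′ = let a , ha = to (⊨-⋁ {m}) h′ in fsuc a , ha
    g : (∃ λ a → β ⊨ φ a) → β ⊨ ⋁ φ
    g (fzero  , h) = from ⊨-disj (inj₁ h)
    g (fsuc a , h) = from ⊨-disj (inj₂ (from (⊨-⋁ {m}) (a , h)))

  ⊨-literal : ∀ c → β ⊨ literal c φ ⇔ sat 𝔄 β φ ≡ c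
  ⊨-literal true = ⊨-true
  ⊨-literal {β} {φ} false = mk⇔ (λ h → to T-not-≡ (holds h)) (λ e → ⟪ from T-not-≡ e ⟫)

  ⊨-exists≥ : β ⊨ exists≥ m z φ ⇔ m ≤ count (λ u → sat 𝔄 (update β z u) φ)
  ⊨-exists≥ = mk⇔ (λ h → toWitness (holds h)) (λ le → ⟪ fromWitness le ⟫)

  ⊨-exists : β ⊨ exists≥ 1 z φ ⇔ ∃ λ u → update β z u ⊨ φ
  ⊨-exists = mk⇔ (λ h → let u , hu = count-positive (to ⊨-exists≥ h) in u , ⟪ hu ⟫)
                 (λ (u , h) → from ⊨-exists≥ (positive-count u (holds h)))

  ⊨-exactly : β ⊨ exactly m z φ ⇔ count (λ u → sat 𝔄 (update β z u) φ) ≡ m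
  ⊨-exactly = mk⇔
    (λ h → let h₁ , h₂ = to ⊨-conj h in
      ≤-antisym (≮⇒≥ (to ⊨-neg h₂ ∘ from ⊨-exists≥)) (to ⊨-exists≥ h₁))
    (λ e → from ⊨-conj (from ⊨-exists≥ (≤-reflexive (sym e)) ,
                        from ⊨-neg (λ h → <-irrefl (sym e) (to ⊨-exists≥ h))))

  ⊨-eq : β ⊨ eq x y ⇔ β x ≡ β y
  ⊨-eq = mk⇔ (λ h → toWitness (holds h)) (λ e → ⟪ fromWitness e ⟫)

  ⊨-assumption : ∀ {x y} j b i c → β ⊨ assumption x y j b i c ⇔ (β x ≡ β y × i ≡ j × c ≡ b)
  ⊨-assumption j b i c with (i ℕ.≟ j) ×-dec (c Bool.≟ b)
  ... | yes (p , q) = mk⇔ (λ h → to ⊨-eq h , p , q) λ (e , _) → from ⊨-eq e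
  ... | no ¬pq = mk⇔ (λ h → ⊥-elim (to ⊨-neg h (from ⊨-eq refl))) λ (_ , pq) → ⊥-elim (¬pq pq)

-- Meaning and soundness of the derivation rules.

record Distinct {k} (x y z : Fin k) : Set where
  constructor distinct
  field
    x≢y : x ≢ y
    x≢z : x ≢ z
    y≢z : y ≢ z

-- The recursive calls of `derive` permute the variables. A claim about a new node exchanges subject
-- and scratch; the second half of a cut makes the cut node the assumption and frees `y` as scratch.
swap₁₃ : ∀ {k} {x y z : Fin k} → Distinct x y z → Distinct z y x
swap₁₃ (distinct x≢y x≢z y≢z) = distinct (≢-sym y≢z) (≢-sym x≢z) (≢-sym x≢y)

swap₂₃ : ∀ {k} {x y z : Fin k} → Distinct x y z → Distinct x z y
swap₂₃ (distinct x≢y x≢z y≢z) = distinct x≢z x≢y (≢-sym y≢z)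

module Semantics (k n : ℕ) (G : DiGraph) (order≤n : order G ≤ n) (C X : V G → ℕ → Bool)
                 (closed : ClosedX G C X) where

  open Unravelling G using (next)
  open Satisfaction {k} (𝒜 n G C)

  private 𝔄 = 𝒜 n G C

  X-zero : ∀ v → X v 0 ≡ false
  X-zero = proj₁ closed

  X-suc : ∀ v i → X v (suc i) ≡ C v (count λ w → E G v w ∧ X w (next w i))
  X-suc v i = proj₂ closed v (suc i) (s≤s z≤n)

  ⋁-bounded : ∀ {β} {m} (φ : ℕ → Formula k n) l → l ≤ m → β ⊨ φ l → β ⊨ ⋁ {m = m} (φ ∘ toℕ)
  ⋁-bounded {β} {m} φ l l≤m h =
    from (⊨-⋁ {m}) (fromℕ< (s≤s l≤m) , subst (λ l → β ⊨ φ l) (sym (toℕ-fromℕ< (s≤s l≤m))) h)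

  module _ {x z : Fin k} (x≢z : x ≢ z) (β : Fin k → V G) where

    sat-rel : ∀ u → sat 𝔄 (update β z u) (rel x z) ≡ E G (β x) u
    sat-rel u = cong₂ (E G) (update-other β z u x≢z) (update-same β z u)

    ⊨-atInDegree : ∀ u (φ : ℕ → Formula k n) →
                   update β z u ⊨ atInDegree x z φ ⇔ update β z u ⊨ φ (indeg G u)
    ⊨-atInDegree u φ = mk⇔ f g
      where
      β′ = update β z u
      edges : ∀ w → sat 𝔄 (update β′ x w) (rel x z) ≡ E G w u
      edges w = cong₂ (E G) (update-same β′ x w)
                  (trans (update-other β′ x w (≢-sym x≢z)) (update-same β z u))
      f : β′ ⊨ atInDegree x z φ → β′ ⊨ φ (indeg G u)
      f h = let d , h₁ = to (⊨-⋁ {n}) h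
                h₂ , h₃ = to ⊨-conj h₁
            in subst (λ d → β′ ⊨ φ d) (trans (sym (to ⊨-exactly h₂)) (count-cong edges)) h₃
      g : β′ ⊨ φ (indeg G u) → β′ ⊨ atInDegree x z φ
      g h = ⋁-bounded (λ d → conj (exactly d x (rel x z)) (φ d)) (indeg G u)
              (≤-trans (count≤ λ w → E G w u) order≤n)
              (from ⊨-conj (from ⊨-exactly (count-cong edges) , h))

    module _ {i : ℕ} (φ : Bool → ℕ → Formula k n)
             (sound : ∀ u b → update β z u ⊨ φ b (indeg G u) → X u (next u i) ≡ b) where

      Total : Set
      Total = ∀ u → E G (β x) u ≡ true → ∃ λ b → update β z u ⊨ φ b (indeg G u)

      private
        child : Bool → Formula k n
        child b = atInDegree x z (φ b)

        ⊨-child : ∀ u → update β z u ⊨ disj (child true) (child false) ⇔ ∃ λ b → update β z u ⊨ φ b (indeg G u)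
        ⊨-child u = mk⇔ f g
          where
          f : update β z u ⊨ disj (child true) (child false) → ∃ λ b → update β z u ⊨ φ b (indeg G u)
          f h with to ⊨-disj h
          ... | inj₁ h₁ = true  , to (⊨-atInDegree u (φ true)) h₁
          ... | inj₂ h₂ = false , to (⊨-atInDegree u (φ false)) h₂
          g : (∃ λ b → update β z u ⊨ φ b (indeg G u)) → update β z u ⊨ disj (child true) (child false)
          g (true  , h) = from ⊨-disj (inj₁ (from (⊨-atInDegree u (φ true)) h))
          g (false , h) = from ⊨-disj (inj₂ (from (⊨-atInDegree u (φ false)) h))

        ⊨-total : β ⊨ neg (exists≥ 1 z (conj (rel x z) (neg (disj (child true) (child false))))) ⇔ Total
        ⊨-total = mk⇔
          (λ h u e → to (⊨-child u) (stable λ ¬h → to ⊨-neg h (from ⊨-exists (u ,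
            from ⊨-conj (from ⊨-true (trans (sat-rel u) e) , from ⊨-neg ¬h)))))
          (λ t → from ⊨-neg λ h →
            let u , hu = to ⊨-exists h
                h₁ , h₂ = to ⊨-conj hu
            in to ⊨-neg h₂ (from (⊨-child u) (t u (trans (sym (sat-rel u)) (to ⊨-true h₁)))))

        -- Totality gives each child some derived value and soundness makes that value the right
        -- one, so the formula counts exactly the out-neighbours in `X`.
        sat-child : Total → ∀ u → sat 𝔄 (update β z u) (conj (rel x z) (child true)) ≡ E G (β x) u ∧ X u (next u i)
        sat-child t u with E G (β x) u in e
        ... | false rewrite trans (sat-rel u) e = refl
        ... | true rewrite trans (sat-rel u) e with t u e
        ...   | true , h = trans (to ⊨-true (from (⊨-atInDegree u (φ true)) h)) (sym (sound u true h))
        -- A derived `false` does not by itself refute the formula for `true`. Should that formula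
        -- hold, its own soundness yields the equation.
        ...   | false , h with sat 𝔄 (update β z u) (child true) in eq
        ...     | true  = sym (sound u true (to (⊨-atInDegree u (φ true)) (from ⊨-true eq)))
        ...     | false = sym (sound u false h)

        true-children : ℕ
        true-children = count λ u → sat 𝔄 (update β z u) (conj (rel x z) (child true))

        C-true-children : Total → C (β x) true-children ≡ X (β x) (suc i)
        C-true-children t = trans (cong (C (β x)) (count-cong (sat-child t))) (sym (X-suc (β x) i))

      -- A child without a value would be missing from the count and could falsify it; the first
      -- conjunct of `step` excludes this. The count is then the one in the defining equation of
      -- `X`.
      ⊨-step : ∀ c → β ⊨ step x z φ c ⇔ (Total × X (β x) (suc i) ≡ c)
      ⊨-step c = mk⇔ f g
        where
        f : β ⊨ step x z φ c → Total × X (β x) (suc i) ≡ c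
        f h = let h₁ , h₂ = to ⊨-conj h
                  t = to ⊨-total h₁
                  m , h₃ = to (⊨-⋁ {n}) h₂
                  h₄ , h₅ = to ⊨-conj h₃
              in t , trans (sym (C-true-children t))
                       (trans (cong (C (β x)) (to ⊨-exactly h₄)) (to (⊨-literal {φ = pred m x} c) h₅))
        g : Total × X (β x) (suc i) ≡ c → β ⊨ step x z φ c
        g (t , Xc) = from ⊨-conj (from ⊨-total t , from (⊨-⋁ {n}) (m ,
          from ⊨-conj (from ⊨-exactly (sym m≡) ,
                       from (⊨-literal c) (trans (cong (C (β x)) m≡) (trans (C-true-children t) Xc)))))
          where
          bound : true-children < suc n
          bound = s≤s (≤-trans (count≤ _) order≤n)
          m = fromℕ< bound
          m≡ : toℕ m ≡ true-children
          m≡ = toℕ-fromℕ< bound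

  ⊨-cut : ∀ {z β m} (φ : Bool → ℕ → Formula k n) →
          β ⊨ cut z {m} φ → ∃ λ u → ∃ λ b → ∃ λ l → update β z u ⊨ φ b l
  ⊨-cut {m = m} φ h with to (⊨-⋁ {m}) h
  ... | l , h₁ with to ⊨-exists h₁
  ...   | u , h₂ with to ⊨-disj h₂
  ...     | inj₁ h₃ = u , true  , toℕ l , h₃
  ...     | inj₂ h₃ = u , false , toℕ l , h₃

  cut-⊨ : ∀ {z β m} (φ : Bool → ℕ → Formula k n) u b l → l ≤ m →
          update β z u ⊨ φ b l → β ⊨ cut z {m} φ
  cut-⊨ {z} {β} φ u b l l≤m h =
    ⋁-bounded (λ l → exists≥ 1 z (disj (φ true l) (φ false l))) l l≤m
      (from ⊨-exists (u , from ⊨-disj (side b h)))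
    where
    side : ∀ b → update β z u ⊨ φ b l → update β z u ⊨ φ true l ⊎ update β z u ⊨ φ false l
    side true  = inj₁
    side false = inj₂

  assumption-sound : ∀ {x y} β j b i c → X (β y) j ≡ b →
                     β ⊨ assumption x y j b i c → X (β x) i ≡ c
  assumption-sound β j b i c Xy h with to (⊨-assumption j b i c) h
  ... | x≡y , refl , refl = trans (cong (λ v → X v j) x≡y) Xy

  module _ {x y z : Fin k} (d : Distinct x y z) (β : Fin k → V G) (u : V G) where
    open Distinct d

    update-x : update β z u x ≡ β x
    update-x = update-other β z u x≢z

    update-y : update β z u y ≡ β y
    update-y = update-other β z u y≢z

  -- Induction on the rounds: wrong guesses cannot be derived from a true assumption. In a cut, the
  -- first half establishes the value at `z`, which is then a true assumption for the second half.
  derive-sound : ∀ s {x y z} → Distinct x y z → ∀ β j b i c → X (β y) j ≡ b →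
                 β ⊨ derive s x y z j b i c → X (β x) i ≡ c
  child-sound : ∀ s {x y z} → Distinct x y z → ∀ β j b i → X (β y) j ≡ b → ∀ u b′ →
                update β z u ⊨ derive s z y x j b (next u i) b′ → X u (next u i) ≡ b′

  child-sound s {z = z} d β j b i Xy u b′ h =
    trans (cong (λ v → X v (next u i)) (sym (update-same β z u)))
      (derive-sound s (swap₁₃ d) (update β z u) j b (next u i) b′
        (trans (cong (λ v → X v j) (update-y d β u)) Xy) h)

  derive-sound s {x} d β j b zero c Xy h = trans (X-zero (β x)) (value c h)
    where
    value : ∀ c → β ⊨ literal (not c) (eq x x) → false ≡ c
    value false h = refl
    value true  h = ⊥-elim (to ⊨-neg h (from ⊨-eq refl))
  derive-sound zero d β j b (suc i) c Xy h = assumption-sound β j b (suc i) c Xy h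
  derive-sound (suc s) {x} {y} {z} d β j b (suc i) c Xy h with to ⊨-disj h
  ... | inj₁ h₁ = assumption-sound β j b (suc i) c Xy h₁
  ... | inj₂ h₂ with to ⊨-disj h₂
  ...   | inj₁ h₃ = proj₂ (to (⊨-step (Distinct.x≢z d) β (λ b′ l → derive s z y x j b (divℕ i l) b′)
                            (child-sound s d β j b i Xy) c) h₃)
  ...   | inj₂ h₃ with ⊨-cut {m = suc i} (λ b′ l → conj (derive s z y x j b l b′) (derive s x z y l b′ (suc i) c)) h₃
  ...     | u , b′ , l , h₄ =
    let h₅ , h₆ = to ⊨-conj h₄
        Xz = derive-sound s (swap₁₃ d) (update β z u) j b l b′
               (trans (cong (λ v → X v j) (update-y d β u)) Xy) h₅
    in trans (cong (λ v → X v (suc i)) (sym (update-x d β u)))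
         (derive-sound s (swap₂₃ d) (update β z u) l b′ (suc i) c Xz h₆)

  Derivable : ℕ → V G → ℕ → V G → ℕ → Set
  Derivable s v i w j = ∀ {x y z} → Distinct x y z → ∀ β → β x ≡ v → β y ≡ w →
                        β ⊨ derive s x y z j (X w j) i (X v i)

  derivable-zero : ∀ s v w j → Derivable s v 0 w j
  derivable-zero s v w j {x} _ β _ _ rewrite X-zero v = from (⊨-eq {β} {x} {x}) refl

  derivable-assumption : ∀ s v i → Derivable s v i v i
  derivable-assumption s       v zero            = derivable-zero s v v 0
  derivable-assumption zero    v (suc i) _ β βx βy =
    from (⊨-assumption (suc i) _ (suc i) _) (trans βx (sym βy) , refl , refl)
  derivable-assumption (suc s) v (suc i) _ β βx βy =
    from ⊨-disj (inj₁ (from (⊨-assumption (suc i) _ (suc i) _) (trans βx (sym βy) , refl , refl)))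

  derivable-step : ∀ s v i w j → (∀ u → E G v u ≡ true → Derivable s u (next u i) w j) →
                   Derivable (suc s) v (suc i) w j
  derivable-step s v i w j children {x} {y} {z} d β refl refl =
    from ⊨-disj (inj₂ (from ⊨-disj (inj₁
      (from (⊨-step (Distinct.x≢z d) β (λ b′ l → derive s z y x j (X w j) (divℕ i l) b′)
              (child-sound s d β j (X w j) i refl) (X v (suc i)))
        ((λ u e → X u (next u i) ,
                  children u e (swap₁₃ d) (update β z u) (update-same β z u) (update-y d β u)) , refl)))))

  derivable-cut : ∀ s v i u l w j → l ≤ suc i → Derivable s u l w j → Derivable s v (suc i) u l →
                  Derivable (suc s) v (suc i) w j
  derivable-cut s v i u l w j l≤i D₁ D₂ {x} {y} {z} d β refl refl =
    from ⊨-disj (inj₂ (from ⊨-disj (inj₂ (cut-⊨ {m = suc i}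
      (λ b′ l → conj (derive s z y x j (X w j) l b′) (derive s x z y l b′ (suc i) (X v (suc i))))
      u (X u l) l l≤i
      (from ⊨-conj (D₁ (swap₁₃ d) (update β z u) (update-same β z u) (update-y d β u) ,
                    D₂ (swap₂₃ d) (update β z u) (update-x d β u) (update-same β z u)))))))

-- Halving a difference of weights or a product of resource and weight.

m+n≤2k⇒2[m∸k]≤m∸n : ∀ m n k → m + n ≤ 2 * k → 2 * (m ∸ k) ≤ m ∸ n
m+n≤2k⇒2[m∸k]≤m∸n m n k h = begin
  2 * (m ∸ k)        ≡⟨ *-distribˡ-∸ 2 m k ⟩
  2 * m ∸ 2 * k      ≤⟨ ∸-monoʳ-≤ (2 * m) h ⟩
  2 * m ∸ (m + n)    ≡⟨ cong (λ l → m + l ∸ (m + n)) (+-identityʳ m) ⟩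
  m + m ∸ (m + n)    ≡⟨ [m+n]∸[m+o]≡n∸o m m n ⟩
  m ∸ n              ∎
  where open ≤-Reasoning

2k≤m+n⇒2[k∸n]≤m∸n : ∀ m n k → 2 * k ≤ m + n → 2 * (k ∸ n) ≤ m ∸ n
2k≤m+n⇒2[k∸n]≤m∸n m n k h = begin
  2 * (k ∸ n)        ≡⟨ *-distribˡ-∸ 2 k n ⟩
  2 * k ∸ 2 * n      ≤⟨ ∸-monoˡ-≤ (2 * n) h ⟩
  m + n ∸ 2 * n      ≡⟨ cong₂ _∸_ (+-comm m n) (cong (n +_) (+-identityʳ n)) ⟩
  n + m ∸ (n + n)    ≡⟨ [m+n]∸[m+o]≡n∸o n m n ⟩
  m ∸ n              ∎
  where open ≤-Reasoning

halfˡ : ∀ p a i t W → 2 * a ≤ i → t ≤ W → i * W < 2 ^ suc p → a * t < 2 ^ p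
halfˡ p a i t W 2a≤i t≤W h = *-cancelˡ-< 2 (a * t) (2 ^ p) (begin-strict
  2 * (a * t)  ≡⟨ *-assoc 2 a t ⟨
  2 * a * t    ≤⟨ *-mono-≤ 2a≤i t≤W ⟩
  i * W        <⟨ h ⟩
  2 ^ suc p    ∎)
  where open ≤-Reasoning

halfʳ : ∀ p a i t W → a ≤ i → 2 * t ≤ W → i * W < 2 ^ suc p → a * t < 2 ^ p
halfʳ p a i t W a≤i 2t≤W h =
  subst (_< 2 ^ p) (*-comm t a) (halfˡ p t W a i 2t≤W a≤i (subst (_< 2 ^ suc p) (*-comm i W) h))

divℕ-half : ∀ a d → d ≢ 1 → 2 * divℕ a d ≤ a
divℕ-half a zero          d≢1 = z≤n
divℕ-half a 1             d≢1 = ⊥-elim (d≢1 refl)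
divℕ-half a d@(suc (suc e)) d≢1 = ≤-trans (*-monoˡ-≤ (divℕ a d) (s≤s (s≤s (z≤n {e})))) (*-divℕ-≤ a d)

-- Derivations in logarithmically many rounds.

module Completeness (k n : ℕ) (G : DiGraph) (order≤n : order G ≤ n) (C X : V G → ℕ → Bool)
                    (closed : ClosedX G C X) where

  open Unravelling G
  open Paths G
  open Semantics k n G order≤n C X closed

  mutual
    -- Each halving costs four rounds. The cut at the heavy end takes one of them and leaves
    -- `4 * p + 3`, just what the path needs at exponent `p`; expanding the heavy end takes one more
    -- round before its children, also at exponent `p`.
    derivable-node : ∀ p s → 4 * p ≤ s → ∀ v i w j → i * weight v i < 2 ^ p → Derivable s v i w j
    derivable-node p       s _   v zero    w j h = derivable-zero s v w j
    derivable-node zero    s _   v (suc i) w j h = ⊥-elim (<⇒≱ h (*-mono-≤ (s≤s (z≤n {i})) (0<weight v i)))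
    derivable-node (suc p) s p≤s v (suc i) w j h with ≤-trans (≤-reflexive (sym (*-suc 4 p))) p≤s
    derivable-node (suc p) (suc (suc s)) _ v (suc i) w j h | s≤s (s≤s 2+4p≤s) =
      let B = weight v (suc i)
          v′ , i′ , path , heavy , light = heavy-end B i v (m<m+n B (<-≤-trans (0<weight v i) (m≤m+n B 0)))
          i′<i = path-≤ path
          children : ∀ u → E G v′ u ≡ true → Derivable s u (next u i′) w j
          children u e = derivable-node p s (≤-trans (m≤n+m (4 * p) 2) 2+4p≤s) u (next u i′) w j
            (light-child e (<⇒≤ i′<i) (path-weight path) light)
      in derivable-cut (suc s) v i v′ (suc i′) w j i′<i
           (derivable-step s v′ i′ w j children)
           (derivable-path p (suc s) (≤-trans (≤-reflexive (+-comm (4 * p) 3)) (s≤s 2+4p≤s)) path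
             (halfʳ p (suc i) (suc i) (B ∸ weight v′ (suc i′)) B ≤-refl
               (m+n≤2k⇒2[m∸k]≤m∸n B 0 (weight v′ (suc i′))
                 (≤-trans (≤-reflexive (+-identityʳ B)) (<⇒≤ heavy))) h))
      where
      -- In-degree 1 keeps the resource, but then the child is light and the weight halves. Any
      -- other in-degree halves the resource.
      light-child : ∀ {v′ i′ u} → E G v′ u ≡ true → i′ ≤ suc i → weight v′ (suc i′) ≤ weight v (suc i) →
                    (∀ y → E G v′ y ≡ true → indeg G y ≡ 1 → 2 * weight y i′ ≤ weight v (suc i)) →
                    next u i′ * weight u (next u i′) < 2 ^ p
      light-child {v′} {i′} {u} e i′≤i weight≤ light with indeg G u ℕ.≟ 1
      ... | yes d = subst (λ l → l * weight u l < 2 ^ p) (sym (next-indeg-1 i′ d))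
        (halfʳ p i′ (suc i) (weight u i′) (weight v (suc i)) i′≤i (light u e d) h)
      ... | no d≢1 = halfˡ p (next u i′) (suc i) (weight u (next u i′)) (weight v (suc i))
        (≤-trans (divℕ-half i′ (indeg G u) d≢1) i′≤i)
        (≤-trans (<⇒≤ (weight-child i′ e)) weight≤) h

    -- The assumption at the end stands in for the tree below it, so only the difference of weights
    -- matters. Branches off the path are treated by `derivable-node` at the same exponent after two
    -- cuts and one step; these three rounds are the summand 3.
    derivable-path : ∀ p s → 4 * p + 3 ≤ s → ∀ {v i w j} → Path v i w j →
                     i * (weight v i ∸ weight w j) < 2 ^ p → Derivable s v i w j
    derivable-path p s _ {v} {i} nil h = derivable-assumption s v i
    derivable-path zero s _ (cons {i = i} e d path) h =
      ⊥-elim (<⇒≱ h (*-mono-≤ (s≤s (z≤n {i})) (m<n⇒0<n∸m (≤-<-trans (path-weight path) (weight-edge i e d)))))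
    derivable-path (suc p) s p≤s path@(cons {i = i} e d _) h
      with ≤-trans (≤-reflexive (cong (_+ 3) (sym (*-suc 4 p)))) p≤s
    derivable-path (suc p) (suc (suc (suc s))) _ {v} {w = w} {j} path@(cons {i = i} e d rest) h
      | s≤s (s≤s (s≤s 1+4p+3≤s)) =
      let x , y , l , before , e′ , d′ , after , heavy , light =
            -- The predicate says, without division, that the weight is at least the mean of the two
            -- end values.
            crossing (λ x l → weight v (suc i) + weight w j ≤? 2 * weight x l) path
              (+-monoʳ-≤ (weight v (suc i)) (≤-trans (path-weight path) (m≤m+n _ 0)))
              (<⇒≱ (+-mono-<-≤ (≤-<-trans (path-weight rest) (weight-edge i e d))
                               (≤-reflexive (+-identityʳ (weight w j)))))
          l<i = path-≤ before
          diff≤ = ∸-mono (path-weight before) (path-weight after)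
      in derivable-cut (suc (suc s)) v i x (suc l) w j l<i
           -- The crossing edge itself is bridged by expanding `x` under an assumed value at `y`,
           -- which the lower half of the path supplies.
           (derivable-cut (suc s) x l y l w j (n≤1+n l)
             (derivable-path p (suc s) (m≤n⇒m≤1+n 4p+3≤s) after
               (halfʳ p l (suc i) (weight y l ∸ weight w j) (W₀ ∸ weight w j) (<⇒≤ l<i)
                 (2k≤m+n⇒2[k∸n]≤m∸n W₀ (weight w j) (weight y l) (<⇒≤ (≰⇒> light))) h))
             (derivable-step s x l y l (other-child e′ d′ (<⇒≤ l<i) diff≤)))
           (derivable-path p (suc (suc s)) (m≤n⇒m≤1+n (m≤n⇒m≤1+n 4p+3≤s)) before
             (halfʳ p (suc i) (suc i) (W₀ ∸ weight x (suc l)) (W₀ ∸ weight w j) ≤-refl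
               (m+n≤2k⇒2[m∸k]≤m∸n W₀ (weight w j) (weight x (suc l)) heavy) h))
      where
      W₀ : ℕ
      W₀ = weight v (suc i)

      4p+3≤s : 4 * p + 3 ≤ s
      4p+3≤s = <⇒≤ 1+4p+3≤s

      -- The child `y` is the assumption. By `weight-children` any other child weighs at most the
      -- drop along the crossing edge, hence at most the drop along the whole path.
      other-child : ∀ {x y l} → E G x y ≡ true → indeg G y ≡ 1 → l ≤ suc i →
                    weight x (suc l) ∸ weight y l ≤ weight v (suc i) ∸ weight w j →
                    ∀ u → E G x u ≡ true → Derivable s u (next u l) y l
      other-child {x} {y} {l} e′ d′ l≤i diff≤ u e″ with u ≟ y
      ... | yes refl = subst (λ l′ → Derivable s u l′ u l) (sym (next-indeg-1 l d′)) (derivable-assumption s u l)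
      ... | no u≢y = derivable-node (suc p) s
        (≤-trans (≤-reflexive (trans (*-suc 4 p) (+-comm 4 (4 * p)))) (≤-trans (≤-reflexive (+-suc (4 * p) 3)) 1+4p+3≤s))
        u (next u l) y l
        (≤-<-trans (*-mono-≤ (≤-trans (divℕ-≤ l (indeg G u)) l≤i) (≤-trans weight-u≤ diff≤)) h)
        where
        weight-u≤ : weight u (next u l) ≤ weight x (suc l) ∸ weight y l
        weight-u≤ = m+n≤o⇒m≤o∸n _ (subst (λ l′ → weight u (next u l) + weight y l′ ≤ weight x (suc l))
          (next-indeg-1 l d′) (<⇒≤ (weight-children l e″ e′ u≢y)))

-- The number of rounds.

n<2^1+⌊log₂n⌋ : ∀ n → n < 2 ^ suc ⌊log₂ n ⌋
n<2^1+⌊log₂n⌋ n = ≰⇒> λ h → <-irrefl refl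
  (≤-trans (≤-reflexive (sym (⌊log₂[2^n]⌋≡n (suc ⌊log₂ n ⌋)))) (⌊log₂⌋-mono-≤ h))

-- With `M = suc n ^ r`, resource times weight is at most `n * M ^ 3`, which is below
-- `suc n ^ suc (3 * r)`; and `suc n` is at most 2 to the power `suc ⌊log₂ n ⌋`.
exponent : ℕ → ℕ → ℕ
exponent n r = suc ⌊log₂ n ⌋ * suc (3 * r)

-- Beyond the `4 * exponent n r` rounds, one level is for the innermost in-degree count and one for
-- the outer quantifier over `x₁`.
depth : ℕ → ℕ → ℕ
depth n r = 4 * exponent n r + 2

depth-O : BigO-r-log-n depth
-- For `n ≥ 2` the logarithm `L` is at least 1, so `suc L ≤ L + L` and `suc (3 * r) ≤ r + 3 * r`.
-- The constant is 4 times 2 times 4, plus 2.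
depth-O = 34 , 2 , λ n r 2≤n 2≤r →
  let L = ⌊log₂ n ⌋
      1≤L : 1 ≤ L
      1≤L = ≤-trans (≤-reflexive (sym (⌊log₂[2^n]⌋≡n 1))) (⌊log₂⌋-mono-≤ 2≤n)
      1≤r = ≤-trans (s≤s z≤n) 2≤r
  in begin
    4 * (suc L * suc (3 * r)) + 2            ≤⟨ +-mono-≤ (*-monoʳ-≤ 4 (*-mono-≤ (+-monoˡ-≤ L 1≤L) (+-monoˡ-≤ (3 * r) 1≤r)))
                                                         (*-monoʳ-≤ 2 (*-mono-≤ 1≤r 1≤L)) ⟩
    4 * ((L + L) * (r + 3 * r)) + 2 * (r * L) ≡⟨ solve 2 (λ r L → con 4 :* ((L :+ L) :* (r :+ con 3 :* r)) :+ con 2 :* (r :* L)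
                                                                  := con 34 :* r :* L) refl r L ⟩
    34 * r * L                               ∎
  where open ≤-Reasoning
        open +-*-Solver

resource*weight<2^exponent : ∀ n r i W → i ≤ suc n ^ r → W ≤ i * (n * i) → i * W < 2 ^ exponent n r
resource*weight<2^exponent n r i W i≤ W≤ = begin-strict
  i * W                        ≤⟨ *-mono-≤ i≤ (≤-trans W≤ (*-mono-≤ i≤ (*-monoʳ-≤ n i≤))) ⟩
  M * (M * (n * M))            ≡⟨ solve 2 (λ M n → M :* (M :* (n :* M)) := n :* (M :* (M :* (M :* con 1)))) refl M n ⟩
  n * M ^ 3                    <⟨ *-monoˡ-< (M ^ 3) {{m^n≢0 M 3 {{m^n≢0 (suc n) r}}}} (n<1+n n) ⟩
  suc n * M ^ 3                ≡⟨ cong (suc n *_) (trans (^-*-assoc (suc n) r 3) (cong (suc n ^_) (*-comm r 3))) ⟩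
  suc n ^ suc (3 * r)          ≤⟨ ^-monoˡ-≤ (suc (3 * r)) (n<2^1+⌊log₂n⌋ n) ⟩
  (2 ^ suc ⌊log₂ n ⌋) ^ suc (3 * r) ≡⟨ ^-*-assoc 2 (suc ⌊log₂ n ⌋) (suc (3 * r)) ⟩
  2 ^ exponent n r             ∎
  where open ≤-Reasoning
        open +-*-Solver
        M = suc n ^ r

theorem4 : Σ ℕ λ k → Σ (0 < k) λ k>0 → Σ (ℕ → ℕ → ℕ) λ f → BigO-r-log-n f ×
    (∀ n r → 0 < n → 0 < r → ∀ i → 1 ≤ i → i ≤ (suc n) ^ r →
    Σ (Formula k n) λ φ →
    OnlyFree (fromℕ< k>0) φ × qd φ ≤ f n r ×
    (∀ (G : DiGraph) → order G ≤ n →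
    ∀ (C : V G → ℕ → Bool) → IsCardCond G C →
    ∀ (X : V G → ℕ → Bool) → IsX G C X →
    ∀ (v : V G) →
    (sat (𝒜 n G C) (λ _ → v) φ ≡ true) ⇔ (X v i ≡ true)))
-- The three variables hold the current node, the node of the assumption and a scratch node.
theorem4 = 3 , s≤s z≤n , depth , depth-O , λ n r _ _ i _ i≤ →
  formula n r i , only-free n r i ,
  ≤-trans (s≤s (qd-derive (4 * exponent n r) x₀ x₁ x₂ 0 false i true)) (≤-reflexive (+-comm 2 _)) ,
  λ G order≤n C _ X (closed , _) v → correct n r i i≤ G order≤n C X closed v
  where
  x₀ x₁ x₂ : Fin 3
  x₀ = fzero
  x₁ = fsuc fzero
  x₂ = fsuc (fsuc fzero)

  012-distinct : Distinct x₀ x₁ x₂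
  012-distinct = distinct (λ ()) (λ ()) (λ ())

  -- (x₁ , 0) never belongs to X(G,C), so the assumption on x₁ is void.
  body formula : ∀ n r i → Formula 3 n
  body n r i = derive (4 * exponent n r) x₀ x₁ x₂ 0 false i true
  formula n r i = exists≥ 1 x₁ (body n r i)

  only-free : ∀ n r i → OnlyFree x₀ (formula n r i)
  only-free n r i fzero               _ = refl
  only-free n r i (fsuc fzero)        ()
  only-free n r i (fsuc (fsuc fzero)) h
    with () ← trans (sym h)
      (free-derive (4 * exponent n r) 0 false i true (Distinct.x≢z 012-distinct) (Distinct.y≢z 012-distinct))

  correct : ∀ n r i → i ≤ suc n ^ r → ∀ G → order G ≤ n → ∀ C X → ClosedX G C X → ∀ v →
            (sat (𝒜 n G C) (λ _ → v) (formula n r i) ≡ true) ⇔ (X v i ≡ true)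
  correct n r i i≤ G order≤n C X closed v = mk⇔ sound complete
    where
    open Semantics 3 n G order≤n C X closed
    open Completeness 3 n G order≤n C X closed
    open Unravelling G using (weight; weight≤)
    open Satisfaction {3} (𝒜 n G C)

    sound : sat (𝒜 n G C) (λ _ → v) (formula n r i) ≡ true → X v i ≡ true
    sound h = let u , hu = to ⊨-exists (from ⊨-true h) in
      derive-sound (4 * exponent n r) 012-distinct (update (λ _ → v) x₁ u) 0 false i true (X-zero u) hu

    complete : X v i ≡ true → sat (𝒜 n G C) (λ _ → v) (formula n r i) ≡ true
    -- The node `v` serves as witness for `x₁`. Its value at resource 0 is `false`, so the
    -- assumption built into the formula is the true one.
    complete Xv = to ⊨-true (from ⊨-exists (v ,
      subst₂ (λ b c → update (λ _ → v) x₁ v ⊨ derive (4 * exponent n r) x₀ x₁ x₂ 0 b i c) (X-zero v) Xv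
        (derivable-node (exponent n r) (4 * exponent n r) ≤-refl v i v 0
          (resource*weight<2^exponent n r i (weight v i) i≤ (≤-trans (weight≤ v i) (*-monoʳ-≤ i (*-monoˡ-≤ i order≤n))))
          012-distinct (update (λ _ → v) x₁ v) refl refl)))
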